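{- Let ${\bf n}=n_0n_1n_2\cdots$ be the fixed point starting with $0$ of the morphism $\nu:0\mapsto01,\ 1\mapsto2,\ 2\mapsto0$ (so ${\bf n}=0120010120120\cdots$). Then the critical exponent of ${\bf n}$ equals $(\alpha^2+\alpha+5)/3\approx 2.8711567558605$, where $\alpha$ is the real root of $X^3=X^2+1$.
   Context: A finite word $w=w[0..n]$ has period $p$ ($1\le p\le n+1$) if $w[0..n-p]=w[p..n]$; the smallest period is $\mathrm{per}(w)$, and the exponent of $w$ is $|w|/\mathrm{per}(w)$. The critical exponent of an infinite word is the supremum of the exponents of its nonempty finite factors. -}

module Defs where

open import Data.Nat using (ℕ; zero; suc; _+_; _<_; _≤_)
open import Data.Fin using (Fin; zero; suc)
open import Data.List using (List; []; _∷_; concatMap)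
open import Data.Integer using (+_)
open import Data.Rational using (ℚ; _/_; 0ℚ; 1ℚ) renaming (_+_ to _+ℚ_; _*_ to _*ℚ_; _<_ to _<ℚ_)
open import Data.Product using (_×_)
open import Relation.Binary.PropositionalEquality using (_≡_)
open import Relation.Nullary using (¬_)

ν : Fin 3 → List (Fin 3)
ν zero = zero ∷ suc zero ∷ []
ν (suc zero) = suc (suc zero) ∷ []
ν (suc (suc zero)) = zero ∷ []

νList : List (Fin 3) → List (Fin 3)
νList = concatMap ν

νIter : ℕ → List (Fin 3)
νIter zero = zero ∷ []
νIter (suc k) = νList (νIter k)

-- list lookup with default 0 (never used out of range below: |ν^(i+1)(0)| > i)
nth : List (Fin 3) → ℕ → Fin 3
nth [] _ = zero
nth (x ∷ xs) zero = x
nth (x ∷ xs) (suc i) = nth xs i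

-- the fixed point n = n₀n₁n₂⋯ of ν starting with 0:
-- n_i is the i-th letter of ν^(i+1)(0), each ν^k(0) being a prefix of ν^(k+1)(0)
𝐧 : ℕ → Fin 3
𝐧 i = nth (νIter (suc i)) i

HasPeriod : ℕ → ℕ → ℕ → Set
HasPeriod i m p = (1 ≤ p) × (p ≤ m) × (∀ j → j + p < m → 𝐧 (i + j) ≡ 𝐧 (i + j + p))

IsPer : ℕ → ℕ → ℕ → Set
IsPer i m p = HasPeriod i m p × (∀ q → q < p → ¬ HasPeriod i m q)

-- the rational m / p  (only used with p ≥ 1)
ratio : ℕ → ℕ → ℚ
ratio m zero = 0ℚ
ratio m (suc q) = (+ m) / suc q

-- the real number α (real root of X³ = X² + 1) is encoded by its Dedekind cut:
-- for rational r, r < α  iff  r³ < r² + 1, and r > α iff r³ > r² + 1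
BelowAlpha : ℚ → Set
BelowAlpha r = (r *ℚ r *ℚ r) <ℚ (r *ℚ r +ℚ 1ℚ)

AboveAlpha : ℚ → Set
AboveAlpha r = (r *ℚ r +ℚ 1ℚ) <ℚ (r *ℚ r *ℚ r)

-- f(x) = (x² + x + 5)/3, increasing on x ≥ 0; the claimed value is f(α)
f : ℚ → ℚ
f r = (r *ℚ r +ℚ r +ℚ ((+ 5) / 1)) *ℚ ((+ 1) / 3)

{-# OPTIONS --safe #-}
module Submission where

-- Let N k = |νᵏ(1)|. Two occurrences n[i..e) = n[q..e′) of a word that are followed by distinct
-- letters are, up to a missing initial 1, the images under ν of such a pair further left,
-- prolonged by one letter if the letters following the latter are 0 and 2. Descending until the
-- first letters differ, one finds a k such that q - i ≥ N k and
-- 3 (e - i) ≤ N (k + 2) + N (k + 1) + 2 N k - c with c ∈ {4, 5}, and starting from n₁ and n₂ both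
-- become equalities. An exponent m / p thus compares with f(r) according to the size of
-- F r k = N (k + 2) + N (k + 1) - (r² + r) N k, which is bounded by 3 for all k if r > α and
-- unbounded if r < α. The former needs no knowledge of the complex conjugates of α: N k satisfies
-- a recurrence, perturbed by a term of the sign of r³ - r² - 1, making F r (k + 4) a convex
-- combination of F r k, F r (k + 1) and F r (k + 2).

open import Defs

module Words where

  open import Data.Fin using (Fin; zero; suc; _≟_)
  open import Data.List using (List; []; _∷_; _++_; length; take)
  open import Data.List.Properties using (concatMap-++; length-++; ++-assoc; ++-identityʳ)
  open import Data.Nat using (ℕ; zero; suc; _+_; _∸_; _*_; _≤_; _<_; z≤n; s≤s; z<s; s<s; _≤?_; _<?_)
  open import Data.Nat.Induction using (<-rec)
  open import Data.Nat.Properties hiding (_≟_)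
  open import Data.Nat.Solver using (module +-*-Solver)
  open import Data.Product using (_×_; _,_; proj₁; proj₂; ∃-syntax)
  open import Data.Sum using (_⊎_; inj₁; inj₂)
  open import Relation.Binary.PropositionalEquality using (_≡_; _≢_; refl; sym; trans; cong; cong₂; subst; subst₂; module ≡-Reasoning)
  open import Relation.Nullary using (Dec; yes; no; contradiction; _×-dec_; _→-dec_)
  open import Relation.Nullary.Decidable using (map′)

  pattern 𝟎 = zero
  pattern 𝟏 = suc zero
  pattern 𝟐 = suc (suc zero)

  -- The word as a fixed point of ν

  ∣ν∣ : Fin 3 → ℕ
  ∣ν∣ a = length (ν a)

  first : Fin 3 → Fin 3
  first a = nth (ν a) 0

  nth-++ˡ : ∀ xs {ys} i → i < length xs → nth (xs ++ ys) i ≡ nth xs i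
  nth-++ˡ (x ∷ xs) zero    _         = refl
  nth-++ˡ (x ∷ xs) (suc i) (s<s i<n) = nth-++ˡ xs i i<n

  nth-++ʳ : ∀ xs {ys} i → nth (xs ++ ys) (length xs + i) ≡ nth ys i
  nth-++ʳ []       i = refl
  nth-++ʳ (x ∷ xs) i = nth-++ʳ xs i

  νList-length : ∀ xs → length xs ≤ length (νList xs)
  νList-length []       = z≤n
  νList-length (𝟎 ∷ xs) = s≤s (m≤n⇒m≤1+n (νList-length xs))
  νList-length (𝟏 ∷ xs) = s≤s (νList-length xs)
  νList-length (𝟐 ∷ xs) = s≤s (νList-length xs)

  νIter-suc : ∀ k → ∃[ ys ] (νIter (suc k) ≡ νIter k ++ ys × 1 ≤ length ys)
  νIter-suc zero    = 𝟏 ∷ [] , refl , s≤s z≤n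
  νIter-suc (suc k) with νIter-suc k
  ... | ys , eq , 1≤ = νList ys , trans (cong νList eq) (concatMap-++ ν (νIter k) ys) ,
                       ≤-trans 1≤ (νList-length ys)

  νIter-length : ∀ k → k < length (νIter k)
  νIter-length zero    = z<s
  νIter-length (suc k) with νIter-suc k
  ... | ys , eq , 1≤ rewrite eq | length-++ (νIter k) {ys} =
    subst (_≤ length (νIter k) + length ys) (+-comm (suc k) 1) (+-mono-≤ (νIter-length k) 1≤)

  νIter-prefix : ∀ k d → ∃[ ys ] νIter (d + k) ≡ νIter k ++ ys
  νIter-prefix k zero    = [] , sym (++-identityʳ (νIter k))
  νIter-prefix k (suc d) with νIter-suc (d + k) | νIter-prefix k d
  ... | zs , eq , _ | ys , eq′ =
    ys ++ zs , trans eq (trans (cong (_++ zs) eq′) (++-assoc (νIter k) ys zs))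

  nth-νIter-+ : ∀ k d i → i < length (νIter k) → nth (νIter (d + k)) i ≡ nth (νIter k) i
  nth-νIter-+ k d i i< with νIter-prefix k d
  ... | ys , eq = trans (cong (λ xs → nth xs i) eq) (nth-++ˡ (νIter k) i i<)

  -- Both νᵏ(0) and νⁱ⁺¹(0), which defines `𝐧 i`, are prefixes of a common longer iterate.
  nth-νIter : ∀ k i → i < length (νIter k) → nth (νIter k) i ≡ 𝐧 i
  nth-νIter k i i< = begin
    nth (νIter k) i           ≡⟨ sym (nth-νIter-+ k (suc i) i i<) ⟩
    nth (νIter (suc i + k)) i ≡⟨ cong (λ z → nth (νIter z) i) (+-comm (suc i) k) ⟩
    nth (νIter (k + suc i)) i ≡⟨ nth-νIter-+ (suc i) k i (<-trans (n<1+n i) (νIter-length (suc i))) ⟩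
    𝐧 i                       ∎
    where open ≡-Reasoning

  -- Being opaque, 𝕟 lets unification read off i from 𝕟 i.
  opaque
    𝕟 : ℕ → Fin 3
    𝕟 = 𝐧

    𝕟≡𝐧 : ∀ i → 𝕟 i ≡ 𝐧 i
    𝕟≡𝐧 i = refl

  nth-νIter-𝕟 : ∀ k i → i < length (νIter k) → nth (νIter k) i ≡ 𝕟 i
  nth-νIter-𝕟 k i i< = trans (nth-νIter k i i<) (sym (𝕟≡𝐧 i))

  -- The length of ν(n[0..j)). As n is fixed by ν, the image of the letter at `j` starts at position
  -- `φ j` of n. The variant `φ[ xs ]` for finite words serves to carry this over from the iterates.
  φ : ℕ → ℕ
  φ zero    = 0
  φ (suc j) = φ j + ∣ν∣ (𝕟 j)

  φ[_] : List (Fin 3) → ℕ → ℕ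
  φ[ xs ] j = length (νList (take j xs))

  φ[]-suc : ∀ xs j → j < length xs → φ[ xs ] (suc j) ≡ φ[ xs ] j + ∣ν∣ (nth xs j)
  φ[]-suc (x ∷ xs) zero    _        = trans (length-++ (ν x)) (+-comm (∣ν∣ x) 0)
  φ[]-suc (x ∷ xs) (suc j) (s<s j<) = begin
    length (ν x ++ νList (take (suc j) xs)) ≡⟨ length-++ (ν x) ⟩
    ∣ν∣ x + φ[ xs ] (suc j)                 ≡⟨ cong (∣ν∣ x +_) (φ[]-suc xs j j<) ⟩
    ∣ν∣ x + (φ[ xs ] j + ∣ν∣ (nth xs j))    ≡⟨ sym (+-assoc (∣ν∣ x) _ _) ⟩
    ∣ν∣ x + φ[ xs ] j + ∣ν∣ (nth xs j)      ≡⟨ cong (_+ ∣ν∣ (nth xs j)) (sym (length-++ (ν x))) ⟩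
    length (ν x ++ νList (take j xs)) + ∣ν∣ (nth xs j) ∎
    where open ≡-Reasoning

  nth-νList : ∀ xs j o → j < length xs → o < ∣ν∣ (nth xs j) →
              φ[ xs ] j + o < length (νList xs) × nth (νList xs) (φ[ xs ] j + o) ≡ nth (ν (nth xs j)) o
  nth-νList (x ∷ xs) zero o _ o< =
    subst (o <_) (sym (length-++ (ν x))) (<-≤-trans o< (m≤m+n _ _)) , nth-++ˡ (ν x) o o<
  nth-νList (x ∷ xs) (suc j) o (s<s j<) o< with nth-νList xs j o j< o<
  ... | lt , eq rewrite length-++ (ν x) {νList (take j xs)} | length-++ (ν x) {νList xs}
                      | +-assoc (∣ν∣ x) (φ[ xs ] j) o =
    +-monoʳ-< (∣ν∣ x) lt , trans (nth-++ʳ (ν x) (φ[ xs ] j + o)) eq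

  φ-φ[] : ∀ k j → j ≤ length (νIter k) → φ[ νIter k ] j ≡ φ j
  φ-φ[] k zero    _  = refl
  φ-φ[] k (suc j) j< = trans (φ[]-suc (νIter k) j j<)
    (cong₂ _+_ (φ-φ[] k j (<⇒≤ j<)) (cong ∣ν∣ (nth-νIter-𝕟 k j j<)))

  -- The letter at `j` lies in νʲ⁺¹(0), its image in νʲ⁺²(0), and both words are prefixes of n.
  𝕟-φ : ∀ j o → o < ∣ν∣ (𝕟 j) → 𝕟 (φ j + o) ≡ nth (ν (𝕟 j)) o
  𝕟-φ j o o< = subst (λ a → 𝕟 (φ j + o) ≡ nth (ν a) o) letter (begin
    𝕟 (φ j + o)                           ≡⟨ sym (nth-νIter-𝕟 (2 + j) (φ j + o) (subst (λ z → z + o < length (νIter (2 + j))) φ≡ (proj₁ image))) ⟩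
    nth (νIter (2 + j)) (φ j + o)         ≡⟨ cong (λ z → nth (νIter (2 + j)) (z + o)) (sym φ≡) ⟩
    nth (νIter (2 + j)) (φ[ w ] j + o)    ≡⟨ proj₂ image ⟩
    nth (ν (nth w j)) o                   ∎)
    where
    open ≡-Reasoning
    w = νIter (suc j)
    j< : j < length w
    j< = <-trans (n<1+n j) (νIter-length (suc j))
    letter : nth w j ≡ 𝕟 j
    letter = nth-νIter-𝕟 (suc j) j j<
    φ≡ : φ[ w ] j ≡ φ j
    φ≡ = φ-φ[] (suc j) j (<⇒≤ j<)
    image : φ[ w ] j + o < length (νList w) × nth (νList w) (φ[ w ] j + o) ≡ nth (ν (nth w j)) o
    image = nth-νList w j o j< (subst (λ a → o < ∣ν∣ a) (sym letter) o<)

  𝕟-φ-first : ∀ j → 𝕟 (φ j) ≡ first (𝕟 j)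
  𝕟-φ-first j = trans (cong 𝕟 (sym (+-identityʳ (φ j)))) (𝕟-φ j 0 (0<∣ν∣ (𝕟 j)))
    where
    0<∣ν∣ : ∀ a → 0 < ∣ν∣ a
    0<∣ν∣ 𝟎 = z<s
    0<∣ν∣ 𝟏 = z<s
    0<∣ν∣ 𝟐 = z<s

  𝕟-φ-𝟏 : ∀ {j} → 𝕟 j ≡ 𝟎 → 𝕟 (suc (φ j)) ≡ 𝟏
  𝕟-φ-𝟏 {j} eq = begin
    𝕟 (suc (φ j))    ≡⟨ cong 𝕟 (+-comm 1 (φ j)) ⟩
    𝕟 (φ j + 1)      ≡⟨ 𝕟-φ j 1 (subst (λ a → 1 < ∣ν∣ a) (sym eq) (s<s z<s)) ⟩
    nth (ν (𝕟 j)) 1  ≡⟨ cong (λ a → nth (ν a) 1) eq ⟩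
    𝟏                ∎
    where open ≡-Reasoning

  -- Growth of `φ` and desubstitution

  φ-suc : ∀ {j a} → 𝕟 j ≡ a → φ (suc j) ≡ ∣ν∣ a + φ j
  φ-suc {j} {a} eq = trans (cong (λ a → φ j + ∣ν∣ a) eq) (+-comm (φ j) (∣ν∣ a))

  φ-first : ∀ {j a} → 𝕟 j ≡ a → 𝕟 (φ j) ≡ first a
  φ-first {j} eq = trans (𝕟-φ-first j) (cong first eq)

  -- The length of ν²(a): ν²(0) = 012, ν²(1) = 0, ν²(2) = 01.
  φ²-growth : Fin 3 → ℕ
  φ²-growth 𝟎 = 3
  φ²-growth 𝟏 = 1
  φ²-growth 𝟐 = 2

  φ²-suc : ∀ {j a} → 𝕟 j ≡ a → φ (φ (suc j)) ≡ φ²-growth a + φ (φ j)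
  φ²-suc {j} {𝟎} eq = begin
    φ (φ (suc j))       ≡⟨ cong φ (φ-suc eq) ⟩
    φ (2 + φ j)         ≡⟨ φ-suc (𝕟-φ-𝟏 eq) ⟩
    1 + φ (1 + φ j)     ≡⟨ cong suc (φ-suc (φ-first eq)) ⟩
    3 + φ (φ j)         ∎
    where open ≡-Reasoning
  φ²-suc {j} {𝟏} eq = trans (cong φ (φ-suc eq)) (φ-suc (φ-first eq))
  φ²-suc {j} {𝟐} eq = trans (cong φ (φ-suc eq)) (φ-suc (φ-first eq))

  -- The characteristic equation X³ = X² + 1 of ν in terms of lengths.
  φ³ : ∀ j → φ (φ (φ j)) ≡ φ (φ j) + j
  φ³ zero    = refl
  φ³ (suc j) = by-letter (𝕟 j) refl
    where
    open ≡-Reasoning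
    -- Here `a` is the length of ν² of the letter at `j`; for each of the three letters, ν³ is
    -- longer than ν² by exactly one.
    finish : ∀ a → φ (φ (φ (suc j))) ≡ suc a + φ (φ (φ j)) → φ (φ (suc j)) ≡ a + φ (φ j) →
             φ (φ (φ (suc j))) ≡ φ (φ (suc j)) + suc j
    finish a eq₃ eq₂ = begin
      φ (φ (φ (suc j)))             ≡⟨ eq₃ ⟩
      suc a + φ (φ (φ j))           ≡⟨ cong (suc a +_) (φ³ j) ⟩
      suc a + (φ (φ j) + j)         ≡⟨ solve 3 (λ a x j → con 1 :+ a :+ (x :+ j) := a :+ x :+ (con 1 :+ j)) refl a (φ (φ j)) j ⟩
      a + φ (φ j) + suc j           ≡⟨ cong (_+ suc j) (sym eq₂) ⟩
      φ (φ (suc j)) + suc j         ∎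
      where open +-*-Solver
    by-letter : ∀ a → 𝕟 j ≡ a → φ (φ (φ (suc j))) ≡ φ (φ (suc j)) + suc j
    by-letter 𝟎 eq = finish 3 (trans (cong (λ x → φ (φ x)) (φ-suc eq))
      (trans (φ²-suc (𝕟-φ-𝟏 eq)) (cong suc (φ²-suc (φ-first eq))))) (φ²-suc eq)
    by-letter 𝟏 eq = finish 1 (trans (cong (λ x → φ (φ x)) (φ-suc eq)) (φ²-suc (φ-first eq))) (φ²-suc eq)
    by-letter 𝟐 eq = finish 2 (trans (cong (λ x → φ (φ x)) (φ-suc eq)) (φ²-suc (φ-first eq))) (φ²-suc eq)

  φ-mono-suc : ∀ j → φ j < φ (suc j)
  φ-mono-suc j with 𝕟 j
  ... | 𝟎 = m<m+n (φ j) z<s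
  ... | 𝟏 = m<m+n (φ j) z<s
  ... | 𝟐 = m<m+n (φ j) z<s

  φ-mono-≤ : ∀ {i j} → i ≤ j → φ i ≤ φ j
  φ-mono-≤ {i} {j} i≤j with m≤n⇒∃[o]m+o≡n i≤j
  ... | d , refl = go d
    where
    go : ∀ d → φ i ≤ φ (i + d)
    go zero    = ≤-reflexive (cong φ (sym (+-identityʳ i)))
    go (suc d) = ≤-trans (go d) (subst (λ z → φ (i + d) ≤ φ z) (sym (+-suc i d)) (<⇒≤ (φ-mono-suc (i + d))))

  φ-cancel-< : ∀ {i j} → φ i < φ j → i < j
  φ-cancel-< {i} {j} lt with i <? j
  ... | yes i<j = i<j
  ... | no i≮j  = contradiction lt (≤⇒≯ (φ-mono-≤ (≮⇒≥ i≮j)))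

  suc<φ-suc : ∀ j → suc j < φ (suc j)
  suc<φ-suc zero    = subst (1 <_) (sym (φ-suc (𝕟≡𝐧 0))) (s<s z<s)
  suc<φ-suc (suc j) = ≤-trans (s<s (suc<φ-suc j)) (φ-mono-suc (suc j))

  -- Desubstitution: n is cut into the images of its letters, and only the image ν(0) = 01 has a
  -- second position.
  φ-inverse : ∀ x → ∃[ j ] (x ≡ φ j ⊎ (x ≡ suc (φ j) × 𝕟 j ≡ 𝟎))
  φ-inverse zero = 0 , inj₁ refl
  φ-inverse (suc x) with φ-inverse x
  ... | j , inj₂ (refl , eq) = suc j , inj₁ (sym (φ-suc eq))
  ... | j , inj₁ refl with 𝕟 j in eq
  ...   | 𝟎 = j , inj₂ (refl , eq)
  ...   | 𝟏 = suc j , inj₁ (sym (φ-suc eq))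
  ...   | 𝟐 = suc j , inj₁ (sym (φ-suc eq))

  -- Thus the letter at a position decides which case of `φ-inverse` holds: it is 1 exactly at the
  -- second position of a ν(0).
  first≢𝟏 : ∀ a → first a ≢ 𝟏
  first≢𝟏 𝟎 ()
  first≢𝟏 𝟏 ()
  first≢𝟏 𝟐 ()

  -- The equality n[i..e) = n[q..e′). It grows at the right end, where images are appended and where
  -- the mismatch sits.
  data Match (i q : ℕ) : ℕ → ℕ → Set where
    []   : Match i q i q
    _∷ʳ_ : ∀ {e e′} → Match i q e e′ → 𝕟 e ≡ 𝕟 e′ → Match i q (suc e) (suc e′)

  match-φ : ∀ {i q e e′} → Match i q e e′ → Match (φ i) (φ q) (φ e) (φ e′)
  match-φ [] = []
  match-φ {i} {q} (_∷ʳ_ {e} {e′} M eq) = by-letter (𝕟 e) refl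
    where
    φM = match-φ M
    by-letter : ∀ a → 𝕟 e ≡ a → Match (φ i) (φ q) (φ (suc e)) (φ (suc e′))
    by-letter a eqa = subst₂ (Match (φ i) (φ q)) (sym (φ-suc eqa)) (sym (φ-suc eqa′)) (extend a eqa eqa′)
      where
      eqa′ = trans (sym eq) eqa
      heads : 𝕟 (φ e) ≡ 𝕟 (φ e′)
      heads = trans (φ-first eqa) (sym (φ-first eqa′))
      extend : ∀ a → 𝕟 e ≡ a → 𝕟 e′ ≡ a → Match (φ i) (φ q) (∣ν∣ a + φ e) (∣ν∣ a + φ e′)
      extend 𝟎 p p′ = (φM ∷ʳ heads) ∷ʳ trans (𝕟-φ-𝟏 p) (sym (𝕟-φ-𝟏 p′))
      extend 𝟏 _ _  = φM ∷ʳ heads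
      extend 𝟐 _ _  = φM ∷ʳ heads

  match-≤ : ∀ {i q e e′} → Match i q e e′ → i ≤ e
  match-≤ []       = ≤-refl
  match-≤ (M ∷ʳ _) = m≤n⇒m≤1+n (match-≤ M)

  match-tail : ∀ {i q e e′} → Match i q e e′ → i < e → Match (suc i) (suc q) e e′
  match-tail [] i<i = contradiction i<i (<-irrefl refl)
  match-tail ([] ∷ʳ _) _ = []
  match-tail ((M ∷ʳ eq) ∷ʳ eq′) _ = match-tail (M ∷ʳ eq) (s<s (match-≤ M)) ∷ʳ eq′

  match-nonempty : ∀ {i q e e′} → Match i q e e′ → 𝕟 e ≢ 𝕟 e′ → 𝕟 i ≡ 𝕟 q → i < e
  match-nonempty []       ≢ eq = contradiction eq ≢
  match-nonempty (M ∷ʳ _) _ _  = s≤s (match-≤ M)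

  match-shift : ∀ {i q e e′} → Match i q e e′ → e + q ≡ e′ + i
  match-shift {i} {q} []       = +-comm i q
  match-shift         (M ∷ʳ _) = cong suc (match-shift M)

  match-lookup : ∀ {i q e e′} → Match i q e e′ → ∀ j → i + j < e → 𝕟 (i + j) ≡ 𝕟 (q + j)
  match-lookup {i} [] j lt = contradiction lt (≤⇒≯ (m≤m+n i j))
  match-lookup {i} {q} (_∷ʳ_ {e} {e′} M eq) j lt with i + j <? e
  ... | yes lt′ = match-lookup M j lt′
  ... | no ≮    = trans (cong 𝕟 i+j≡e) (trans eq (cong 𝕟 (sym q+j≡e′)))
    where
    i+j≡e : i + j ≡ e
    i+j≡e = ≤-antisym (≤-pred lt) (≮⇒≥ ≮)
    q+j≡e′ : q + j ≡ e′
    q+j≡e′ = +-cancelʳ-≡ i (q + j) e′ (begin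
      q + j + i ≡⟨ solve 3 (λ q j i → q :+ j :+ i := i :+ j :+ q) refl q j i ⟩
      i + j + q ≡⟨ cong (_+ q) i+j≡e ⟩
      e + q     ≡⟨ match-shift M ⟩
      e′ + i    ∎)
      where
      open ≡-Reasoning
      open +-*-Solver

  -- Lengths of periods and overlaps, types of mismatch

  N : ℕ → ℕ
  N 0 = 1
  N 1 = 1
  N 2 = 1
  N (suc (suc (suc k))) = N (suc (suc k)) + N k

  -- 3|u_k| + 4 = S k or 3|u_k| + 5 = S k, according to the parity of k, where u_k is the
  -- longest overlap obtained from a mismatch after k applications of ν.
  S : ℕ → ℕ
  S k = N (2 + k) + N (1 + k) + 2 * N k

  S-rec : ∀ k → S (3 + k) ≡ S (2 + k) + S k
  S-rec k = solve 5 (λ a b c p q → p :+ c :+ (q :+ b) :+ con 2 :* (c :+ a)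
                                := p :+ q :+ con 2 :* c :+ (c :+ b :+ con 2 :* a))
    refl (N k) (N (1 + k)) (N (2 + k)) (N (4 + k)) (N (3 + k))
    where open +-*-Solver

  -- `with-𝟏` is a mismatch of 1 with another letter, `without-𝟏` one of 0 with 2. They alternate
  -- under ν: ν(0) and ν(2) start with 0 but ν(1) with 2, and the mismatch arising from ν(0) and
  -- ν(2) involves the 1 of ν(0).
  data Phase : Set where
    with-𝟏 without-𝟏 : Phase

  flip : Phase → Phase
  flip with-𝟏    = without-𝟏
  flip without-𝟏 = with-𝟏

  phase : ℕ → Phase
  phase zero    = with-𝟏
  phase (suc k) = flip (phase k)

  data Conflict : Phase → Fin 3 → Fin 3 → Set where
    c₀₁ : Conflict with-𝟏 𝟎 𝟏
    c₁₀ : Conflict with-𝟏 𝟏 𝟎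
    c₁₂ : Conflict with-𝟏 𝟏 𝟐
    c₂₁ : Conflict with-𝟏 𝟐 𝟏
    c₀₂ : Conflict without-𝟏 𝟎 𝟐
    c₂₀ : Conflict without-𝟏 𝟐 𝟎

  conflict : ∀ a b → a ≡ b ⊎ ∃[ P ] Conflict P a b
  conflict 𝟎 𝟎 = inj₁ refl
  conflict 𝟎 𝟏 = inj₂ (_ , c₀₁)
  conflict 𝟎 𝟐 = inj₂ (_ , c₀₂)
  conflict 𝟏 𝟎 = inj₂ (_ , c₁₀)
  conflict 𝟏 𝟏 = inj₁ refl
  conflict 𝟏 𝟐 = inj₂ (_ , c₁₂)
  conflict 𝟐 𝟎 = inj₂ (_ , c₂₀)
  conflict 𝟐 𝟏 = inj₂ (_ , c₂₁)
  conflict 𝟐 𝟐 = inj₁ refl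

  conflict-≢ : ∀ {P a b} → Conflict P a b → a ≢ b
  conflict-≢ c₀₁ ()
  conflict-≢ c₁₀ ()
  conflict-≢ c₁₂ ()
  conflict-≢ c₂₁ ()
  conflict-≢ c₀₂ ()
  conflict-≢ c₂₀ ()

  conflict-𝟏ˡ : ∀ {b} → b ≢ 𝟏 → Conflict with-𝟏 𝟏 b
  conflict-𝟏ˡ {𝟎} _ = c₁₀
  conflict-𝟏ˡ {𝟏} ≢ = contradiction refl ≢
  conflict-𝟏ˡ {𝟐} _ = c₁₂

  conflict-sym : ∀ {P a b} → Conflict P a b → Conflict P b a
  conflict-sym c₀₁ = c₁₀
  conflict-sym c₁₀ = c₀₁
  conflict-sym c₁₂ = c₂₁
  conflict-sym c₂₁ = c₁₂
  conflict-sym c₀₂ = c₂₀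
  conflict-sym c₂₀ = c₀₂

  -- The images of 0 and 2 agree on one more letter: ν(0) = 01, while ν(2) = 0 is followed by 0 or 2.
  extra : Phase → ℕ
  extra with-𝟏    = 0
  extra without-𝟏 = 1

  conflict-φ : ∀ {P e e′} → Conflict P (𝕟 e) (𝕟 e′) →
               Conflict (flip P) (𝕟 (extra P + φ e)) (𝕟 (extra P + φ e′))
  conflict-φ {P} {e} {e′} c = by-letters c refl refl
    where
    not-𝟏 : ∀ {x} → 𝕟 x ≡ 𝟐 → 𝕟 (suc (φ x)) ≢ 𝟏
    not-𝟏 {x} p = subst (_≢ 𝟏) (sym (trans (cong 𝕟 (sym (φ-suc p))) (𝕟-φ-first (suc x)))) (first≢𝟏 (𝕟 (suc x)))
    firsts : ∀ {P a b} → Conflict P (first a) (first b) → 𝕟 e ≡ a → 𝕟 e′ ≡ b → Conflict P (𝕟 (φ e)) (𝕟 (φ e′))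
    firsts c p q = subst₂ (Conflict _) (sym (φ-first p)) (sym (φ-first q)) c
    by-letters : ∀ {P a b} → Conflict P a b → 𝕟 e ≡ a → 𝕟 e′ ≡ b →
                 Conflict (flip P) (𝕟 (extra P + φ e)) (𝕟 (extra P + φ e′))
    by-letters c₀₁ = firsts c₀₂
    by-letters c₁₀ = firsts c₂₀
    by-letters c₁₂ = firsts c₂₀
    by-letters c₂₁ = firsts c₀₂
    by-letters c₀₂ p q = subst (λ a → Conflict _ a _) (sym (𝕟-φ-𝟏 p)) (conflict-𝟏ˡ (not-𝟏 q))
    by-letters c₂₀ p q = subst (λ a → Conflict _ _ a) (sym (𝕟-φ-𝟏 q)) (conflict-sym (conflict-𝟏ˡ (not-𝟏 p)))

  conflict-first : ∀ {a b} → Conflict without-𝟏 a b → first a ≡ 𝟎 × first b ≡ 𝟎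
  conflict-first c₀₂ = refl , refl
  conflict-first c₂₀ = refl , refl

  match-extra : ∀ {P i q e e′} → Conflict P (𝕟 e) (𝕟 e′) → Match i q e e′ →
                Match (φ i) (φ q) (extra P + φ e) (extra P + φ e′)
  match-extra {with-𝟏}    _ M = match-φ M
  match-extra {without-𝟏} {e = e} {e′} c M = match-φ M ∷ʳ trans (𝕟-φ-first e)
    (trans (trans (proj₁ firsts) (sym (proj₂ firsts))) (sym (𝕟-φ-first e′)))
    where firsts = conflict-first c

  -- The additional letter is a 0; the coefficients 2 here and 3 in `φ²-extra` are |ν(0)| and
  -- |ν²(0)|.
  φ-extra : ∀ {P e e′} → Conflict P (𝕟 e) (𝕟 e′) → φ (extra P + φ e) ≡ 2 * extra P + φ (φ e)
  φ-extra {with-𝟏}    _ = refl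
  φ-extra {without-𝟏} {e} c = φ-suc (trans (𝕟-φ-first e) (proj₁ (conflict-first c)))

  φ²-extra : ∀ {P e e′} → Conflict P (𝕟 e) (𝕟 e′) → φ (φ (extra P + φ e)) ≡ 3 * extra P + (φ (φ e) + e)
  φ²-extra {with-𝟏}    {e} _ = φ³ e
  φ²-extra {without-𝟏} {e} c =
    trans (φ²-suc (trans (𝕟-φ-first e) (proj₁ (conflict-first c)))) (cong (3 +_) (φ³ e))

  -- What 3|u|, 3|ν(u)| and 3|ν²(u)| lack of S k, S (1 + k) and S (2 + k), for u = u_k.
  d₀ d₁ d₂ : Phase → ℕ
  d₀ with-𝟏    = 4
  d₀ without-𝟏 = 5
  d₁ with-𝟏    = 5
  d₁ without-𝟏 = 7
  d₂ with-𝟏    = 7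
  d₂ without-𝟏 = 11

  -- Consistency of the constants when u_{k+1} is ν(u_k) followed by `extra P` letters 0, of which ν
  -- and ν² multiply the length by 2 and 3. By `φ³` and `S-rec`, 3|ν³(u_k)| lacks `d₂ P + d₀ P` of S
  -- (3 + k).
  d₁-flip : ∀ P → d₁ P ≡ 3 * extra P + d₀ (flip P)
  d₁-flip with-𝟏    = refl
  d₁-flip without-𝟏 = refl

  d₂-flip : ∀ P → d₂ P ≡ 3 * (2 * extra P) + d₁ (flip P)
  d₂-flip with-𝟏    = refl
  d₂-flip without-𝟏 = refl

  d₃-flip : ∀ P → d₂ P + d₀ P ≡ 3 * (3 * extra P) + d₂ (flip P)
  d₃-flip with-𝟏    = refl
  d₃-flip without-𝟏 = refl

  -- Action of ν on runs

  -- Words are measured by the lengths of w, ν(w) and ν²(w), on which ν acts linearly by φ³.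
  -- The relation _~_ is _≤_ for the upper bound and _≡_ for the lower bound.
  module Runs (_~_ : ℕ → ℕ → Set) (~-+ : ∀ {a b c d} → a ~ b → c ~ d → (a + c) ~ (b + d)) where

    record Overlap (P : Phase) (k i e : ℕ) : Set where
      constructor overlaps
      field
        length₀ : (3 * e + d₀ P) ~ (3 * i + S k)
        length₁ : (3 * φ e + d₁ P) ~ (3 * φ i + S (1 + k))
        length₂ : (3 * φ (φ e) + d₂ P) ~ (3 * φ (φ i) + S (2 + k))

    record Period (k i q : ℕ) : Set where
      constructor period
      field
        length₀ : (i + N k) ~ q
        length₁ : (φ i + N (1 + k)) ~ φ q
        length₂ : (φ (φ i) + N (2 + k)) ~ φ (φ q)

    record Run (k i q : ℕ) : Set where
      constructor run
      field
        {e e′}     : ℕ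
        matching   : Match i q e e′
        mismatch   : Conflict (phase k) (𝕟 e) (𝕟 e′)
        overlapped : Overlap (phase k) k i e
        periodic   : Period k i q

    -- The three conditions shift by one place under ν. The new third one is the sum of the old
    -- third and first, as both `φ³` and `S-rec` follow X³ = X² + 1. The same shift gives
    -- `period-φ`.
    overlap-φ : ∀ {P k i e e′} → Conflict P (𝕟 e) (𝕟 e′) → Overlap P k i e →
                Overlap (flip P) (suc k) (φ i) (extra P + φ e)
    overlap-φ {P} {k} {i} {e} c (overlaps l₀ l₁ l₂) = overlaps
      (subst (_~ (3 * φ i + S (1 + k))) (trans (cong (3 * φ e +_) (d₁-flip P)) (regroup (φ e) (extra P) (d₀ (flip P)))) l₁)
      (subst (_~ (3 * φ (φ i) + S (2 + k))) (trans (cong (3 * φ (φ e) +_) (d₂-flip P)) (trans (regroup (φ (φ e)) (2 * extra P) (d₁ (flip P)))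
        (cong (λ z → 3 * z + d₁ (flip P)) (sym (φ-extra c))))) l₂)
      (subst₂ _~_ left right (~-+ l₂ l₀))
      where
      open +-*-Solver
      open ≡-Reasoning
      regroup : ∀ a x d → 3 * a + (3 * x + d) ≡ 3 * (x + a) + d
      regroup = solve 3 (λ a x d → con 3 :* a :+ (con 3 :* x :+ d) := con 3 :* (x :+ a) :+ d) refl
      left : 3 * φ (φ e) + d₂ P + (3 * e + d₀ P) ≡ 3 * φ (φ (extra P + φ e)) + d₂ (flip P)
      left = begin
        3 * φ (φ e) + d₂ P + (3 * e + d₀ P)
          ≡⟨ solve 4 (λ a b c d → con 3 :* a :+ c :+ (con 3 :* b :+ d) := con 3 :* (a :+ b) :+ (c :+ d))
               refl (φ (φ e)) e (d₂ P) (d₀ P) ⟩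
        3 * (φ (φ e) + e) + (d₂ P + d₀ P)
          ≡⟨ cong (3 * (φ (φ e) + e) +_) (d₃-flip P) ⟩
        3 * (φ (φ e) + e) + (3 * (3 * extra P) + d₂ (flip P))
          ≡⟨ regroup (φ (φ e) + e) (3 * extra P) (d₂ (flip P)) ⟩
        3 * (3 * extra P + (φ (φ e) + e)) + d₂ (flip P)
          ≡⟨ cong (λ z → 3 * z + d₂ (flip P)) (sym (φ²-extra c)) ⟩
        3 * φ (φ (extra P + φ e)) + d₂ (flip P) ∎
      right : 3 * φ (φ i) + S (2 + k) + (3 * i + S k) ≡ 3 * φ (φ (φ i)) + S (3 + k)
      right = begin
        3 * φ (φ i) + S (2 + k) + (3 * i + S k)
          ≡⟨ solve 4 (λ a b c d → con 3 :* a :+ c :+ (con 3 :* b :+ d) := con 3 :* (a :+ b) :+ (c :+ d))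
               refl (φ (φ i)) i (S (2 + k)) (S k) ⟩
        3 * (φ (φ i) + i) + (S (2 + k) + S k)
          ≡⟨ cong₂ (λ x y → 3 * x + y) (sym (φ³ i)) (sym (S-rec k)) ⟩
        3 * φ (φ (φ i)) + S (3 + k) ∎

    period-φ : ∀ {k i q} → Period k i q → Period (suc k) (φ i) (φ q)
    period-φ {k} {i} {q} (period l₀ l₁ l₂) = period l₁ l₂ (subst₂ _~_
      (trans (solve 4 (λ a b c d → a :+ c :+ (b :+ d) := a :+ b :+ (c :+ d)) refl (φ (φ i)) i (N (2 + k)) (N k))
             (cong (_+ N (3 + k)) (sym (φ³ i))))
      (sym (φ³ q)) (~-+ l₂ l₀))
      where open +-*-Solver

    run-φ : ∀ {k i q} → Run k i q → Run (suc k) (φ i) (φ q)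
    run-φ (run M c o p) = run (match-extra c M) (conflict-φ c) (overlap-φ c o) (period-φ p)

  module Bounded = Runs _≤_ +-mono-≤
  module Exact = Runs _≡_ (cong₂ _+_)

  -- Upper bound: descent to a mismatch of first letters

  φ²-growth-≥1 : ∀ a → 1 ≤ φ²-growth a
  φ²-growth-≥1 𝟎 = s≤s z≤n
  φ²-growth-≥1 𝟏 = s≤s z≤n
  φ²-growth-≥1 𝟐 = s≤s z≤n

  φ²-growth-≥2 : ∀ {a b} → Conflict without-𝟏 a b → 2 ≤ φ²-growth a
  φ²-growth-≥2 c₀₂ = s≤s (s≤s z≤n)
  φ²-growth-≥2 c₂₀ = s≤s (s≤s z≤n)

  -- The overlap is empty, and the constants `d₀`, `d₁`, `d₂` are S 0, S 1, S 2 for `with-𝟏` and S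
  -- 1, S 2, S 3 for `without-𝟏`; hence k is 0 or 1. In the latter case N 3 = 2 requires |ν²| ≥ 2
  -- for the letter at `i`, which is 0 or 2.
  run-mismatch : ∀ {P i q} → i < q → Conflict P (𝕟 i) (𝕟 q) → ∃[ k ] Bounded.Run k i q
  run-mismatch {P} {i} {q} i<q c = go P c
    where
    open Bounded
    length₀ : i + 1 ≤ q
    length₀ = subst (_≤ q) (+-comm 1 i) i<q
    length₁ : φ i + 1 ≤ φ q
    length₁ = subst (_≤ φ q) (+-comm 1 (φ i)) (<-≤-trans (φ-mono-suc i) (φ-mono-≤ i<q))
    length₂ : ∀ {g} → g ≤ φ²-growth (𝕟 i) → φ (φ i) + g ≤ φ (φ q)
    length₂ {g} g≤ = begin
      φ (φ i) + g                 ≤⟨ +-monoʳ-≤ (φ (φ i)) g≤ ⟩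
      φ (φ i) + φ²-growth (𝕟 i)   ≡⟨ +-comm (φ (φ i)) _ ⟩
      φ²-growth (𝕟 i) + φ (φ i)   ≡⟨ sym (φ²-suc refl) ⟩
      φ (φ (suc i))               ≤⟨ φ-mono-≤ (φ-mono-≤ i<q) ⟩
      φ (φ q)                     ∎
      where open ≤-Reasoning
    go : ∀ P → Conflict P (𝕟 i) (𝕟 q) → ∃[ k ] Run k i q
    go with-𝟏    c = 0 , run [] c (overlaps ≤-refl ≤-refl ≤-refl)
                         (period length₀ length₁ (length₂ (φ²-growth-≥1 (𝕟 i))))
    go without-𝟏 c = 1 , run [] c (overlaps ≤-refl ≤-refl ≤-refl)
                         (period length₀ length₁ (length₂ (φ²-growth-≥2 c)))

  -- Dropping a common first letter only shortens the overlap, and it moves `i` and `q` and their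
  -- images by equal amounts.
  run-tail : ∀ {k i q} → 𝕟 i ≡ 𝕟 q → Bounded.Run k i q → Bounded.Run k (suc i) (suc q)
  run-tail {k} {i} {q} eq (Bounded.run {e} {e′} M c (Bounded.overlaps o₀ o₁ o₂) (Bounded.period p₀ p₁ p₂)) =
    run (match-tail M (match-nonempty M (conflict-≢ c) eq)) c
      (overlaps (later o₀ (n≤1+n i)) (later o₁ (φ-mono-≤ (n≤1+n i))) (later o₂ (φ-mono-≤ (φ-mono-≤ (n≤1+n i)))))
      (period (s≤s p₀)
        (shifted p₁ (φ-suc refl) (φ-suc (sym eq)))
        (shifted p₂ (φ²-suc refl) (φ²-suc (sym eq))))
    where
    open Bounded
    later : ∀ {x y z s} → x ≤ 3 * y + s → y ≤ z → x ≤ 3 * z + s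
    later {s = s} x≤ y≤z = ≤-trans x≤ (+-monoˡ-≤ s (*-monoʳ-≤ 3 y≤z))
    shifted : ∀ {x x′ y y′ n g} → x + n ≤ y → x′ ≡ g + x → y′ ≡ g + y → x′ + n ≤ y′
    shifted {x} {n = n} {g} le refl refl = ≤-trans (≤-reflexive (+-assoc g x n)) (+-monoʳ-≤ g le)

  -- Strong induction on `q`: equal letters at `i` and `q` have the same place within their images,
  -- so both positions desubstitute, the second one to a smaller `q′`.
  run-exists : ∀ q i → i < q → ∃[ k ] Bounded.Run k i q
  run-exists = <-rec _ step
    where
    step : ∀ q → (∀ {q′} → q′ < q → ∀ i → i < q′ → ∃[ k ] Bounded.Run k i q′) → ∀ i → i < q → ∃[ k ] Bounded.Run k i q
    step q rec i i<q with conflict (𝕟 i) (𝕟 q)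
    ... | inj₂ (_ , c) = run-mismatch i<q c
    ... | inj₁ eq with φ-inverse i | φ-inverse q
    ...   | i′ , inj₁ refl | q′ , inj₁ refl =
      let k , R = rec (smaller q′ i<q) i′ (φ-cancel-< i<q) in suc k , Bounded.run-φ R
      where
      smaller : ∀ q′ → φ i′ < φ q′ → q′ < φ q′
      smaller zero    ()
      smaller (suc j) _ = suc<φ-suc j
    -- Both positions carry the 1 of a ν(0); the run obtained from `i′` and `q′` starts one letter
    -- earlier, at the 0.
    ...   | i′ , inj₂ (refl , z) | q′ , inj₂ (refl , z′) =
      let k , R = rec (s≤s (j≤φ q′)) i′ (φ-cancel-< (≤-pred i<q))
      in suc k , run-tail (trans (φ-first z) (sym (φ-first z′))) (Bounded.run-φ R)
      where
      j≤φ : ∀ j → j ≤ φ j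
      j≤φ zero    = z≤n
      j≤φ (suc j) = <⇒≤ (suc<φ-suc j)
    -- In the mixed cases one letter is 1 and the other starts an image, so they cannot be equal.
    ...   | i′ , inj₁ refl | q′ , inj₂ (refl , z′) =
      contradiction (trans (sym (𝕟-φ-first i′)) (trans eq (𝕟-φ-𝟏 z′))) (first≢𝟏 (𝕟 i′))
    ...   | i′ , inj₂ (refl , z) | q′ , inj₁ refl =
      contradiction (trans (sym (𝕟-φ-first q′)) (trans (sym eq) (𝕟-φ-𝟏 z))) (first≢𝟏 (𝕟 q′))

  -- The period cannot extend past the mismatch that ends the run from `i` and `i + p`, so m ≤ d + p
  -- for the overlap length d. The constant 4 is the smaller value of `d₀`.
  HasPeriod-bound : ∀ {i m p} → HasPeriod i m p → ∃[ k ] (3 * m + 4 ≤ S k + 3 * p × N k ≤ p)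
  HasPeriod-bound {i} {m} {p} (1≤p , p≤m , per)
    with run-exists (i + p) i (m<m+n i 1≤p)
  ... | k , Bounded.run {e} {e′} M c o (Bounded.period p₀ _ _) = k , length-bound , +-cancelˡ-≤ i (N k) p p₀
    where
    overlap₀ : ∀ P → Bounded.Overlap P k i e → 3 * e + 4 ≤ 3 * i + S k
    overlap₀ with-𝟏    o = Bounded.Overlap.length₀ o
    overlap₀ without-𝟏 o = ≤-trans (+-monoʳ-≤ (3 * e) (n≤1+n 4)) (Bounded.Overlap.length₀ o)
    d = e ∸ i
    i+d≡e : i + d ≡ e
    i+d≡e = m+[n∸m]≡n (match-≤ M)
    e′≡ : e′ ≡ i + d + p
    e′≡ = +-cancelʳ-≡ i e′ (i + d + p) (trans (sym (match-shift M)) (begin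
      e + (i + p)     ≡⟨ cong (_+ (i + p)) (sym i+d≡e) ⟩
      i + d + (i + p) ≡⟨ solve 3 (λ i d p → i :+ d :+ (i :+ p) := i :+ d :+ p :+ i) refl i d p ⟩
      i + d + p + i   ∎))
      where
      open ≡-Reasoning
      open +-*-Solver
    agree : d + p < m → 𝕟 e ≡ 𝕟 e′
    agree lt = begin
      𝕟 e            ≡⟨ cong 𝕟 (sym i+d≡e) ⟩
      𝕟 (i + d)      ≡⟨ 𝕟≡𝐧 (i + d) ⟩
      𝐧 (i + d)      ≡⟨ per d lt ⟩
      𝐧 (i + d + p)  ≡⟨ sym (𝕟≡𝐧 (i + d + p)) ⟩
      𝕟 (i + d + p)  ≡⟨ cong 𝕟 (sym e′≡) ⟩
      𝕟 e′           ∎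
      where open ≡-Reasoning
    m≤d+p : m ≤ d + p
    m≤d+p = ≮⇒≥ (λ lt → conflict-≢ c (agree lt))
    length-bound : 3 * m + 4 ≤ S k + 3 * p
    length-bound = +-cancelˡ-≤ (3 * i) _ _ (begin
      3 * i + (3 * m + 4)       ≤⟨ +-monoʳ-≤ (3 * i) (+-monoˡ-≤ 4 (*-monoʳ-≤ 3 m≤d+p)) ⟩
      3 * i + (3 * (d + p) + 4) ≡⟨ solve 3 (λ i d p → con 3 :* i :+ (con 3 :* (d :+ p) :+ con 4)
                                       := con 3 :* (i :+ d) :+ con 4 :+ con 3 :* p) refl i d p ⟩
      3 * (i + d) + 4 + 3 * p   ≡⟨ cong (λ x → 3 * x + 4 + 3 * p) i+d≡e ⟩
      3 * e + 4 + 3 * p         ≤⟨ +-monoˡ-≤ (3 * p) (overlap₀ (phase k) o) ⟩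
      3 * i + S k + 3 * p       ≡⟨ +-assoc (3 * i) (S k) (3 * p) ⟩
      3 * i + (S k + 3 * p)     ∎)
      where
      open ≤-Reasoning
      open +-*-Solver

  -- Lower bound: factors attaining the extremal lengths

  run-exact : ∀ k → ∃[ i ] ∃[ q ] Exact.Run k i q
  -- n₁ = 1 and n₂ = 2 differ, and the distance of the positions is |1| = N 0; likewise |ν(1)| = N 1
  -- and |ν²(1)| = N 2.
  run-exact zero = 1 , 2 , run [] (subst₂ (Conflict _) (sym (𝕟≡𝐧 1)) (sym (𝕟≡𝐧 2)) c₁₂)
    (overlaps refl refl refl)
    (period refl (trans (+-comm (φ 1) 1) (sym (φ-suc (𝕟≡𝐧 1))))
                 (trans (+-comm (φ (φ 1)) 1) (sym (φ²-suc (𝕟≡𝐧 1)))))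
    where open Exact
  run-exact (suc k) = let i , q , R = run-exact k in φ i , φ q , Exact.run-φ R

  N-pos : ∀ k → 1 ≤ N k
  N-pos 0 = ≤-refl
  N-pos 1 = ≤-refl
  N-pos 2 = ≤-refl
  N-pos (suc (suc (suc k))) = ≤-trans (N-pos k) (m≤n+m (N k) (N (2 + k)))

  -- The factor is the overlap prolonged by one period. The constant 5 is the larger value of `d₀`.
  HasPeriod-exists : ∀ k → ∃[ i ] ∃[ m ] (HasPeriod i m (N k) × S k + 3 * N k ≤ 3 * m + 5)
  HasPeriod-exists k with run-exact k
  ... | i , q , Exact.run {e} {e′} M c o (Exact.period p₀ _ _) =
    i , d + N k , (N-pos k , m≤n+m (N k) d , periodic) , length-bound
    where
    overlap₀ : ∀ P → Exact.Overlap P k i e → 3 * i + S k ≤ 3 * e + 5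
    overlap₀ with-𝟏    o = ≤-trans (≤-reflexive (sym (Exact.Overlap.length₀ o))) (+-monoʳ-≤ (3 * e) (n≤1+n 4))
    overlap₀ without-𝟏 o = ≤-reflexive (sym (Exact.Overlap.length₀ o))
    d = e ∸ i
    i+d≡e : i + d ≡ e
    i+d≡e = m+[n∸m]≡n (match-≤ M)
    periodic : ∀ j → j + N k < d + N k → 𝐧 (i + j) ≡ 𝐧 (i + j + N k)
    periodic j lt = begin
      𝐧 (i + j)        ≡⟨ sym (𝕟≡𝐧 (i + j)) ⟩
      𝕟 (i + j)        ≡⟨ match-lookup M j (subst (i + j <_) i+d≡e (+-monoʳ-< i (+-cancelʳ-< (N k) j d lt))) ⟩
      𝕟 (q + j)        ≡⟨ 𝕟≡𝐧 (q + j) ⟩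
      𝐧 (q + j)        ≡⟨ cong (λ x → 𝐧 (x + j)) (sym p₀) ⟩
      𝐧 (i + N k + j)  ≡⟨ cong 𝐧 (solve 3 (λ i n j → i :+ n :+ j := i :+ j :+ n) refl i (N k) j) ⟩
      𝐧 (i + j + N k)  ∎
      where
      open ≡-Reasoning
      open +-*-Solver
    length-bound : S k + 3 * N k ≤ 3 * (d + N k) + 5
    length-bound = +-cancelˡ-≤ (3 * i) _ _ (begin
      3 * i + (S k + 3 * N k)          ≡⟨ sym (+-assoc (3 * i) (S k) (3 * N k)) ⟩
      3 * i + S k + 3 * N k            ≤⟨ +-monoˡ-≤ (3 * N k) (overlap₀ (phase k) o) ⟩
      3 * e + 5 + 3 * N k              ≡⟨ cong (λ x → 3 * x + 5 + 3 * N k) (sym i+d≡e) ⟩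
      3 * (i + d) + 5 + 3 * N k        ≡⟨ solve 3 (λ i d p → con 3 :* (i :+ d) :+ con 5 :+ con 3 :* p
                                            := con 3 :* i :+ (con 3 :* (d :+ p) :+ con 5)) refl i d (N k) ⟩
      3 * i + (3 * (d + N k) + 5)      ∎)
      where
      open ≤-Reasoning
      open +-*-Solver

  -- The condition `j + p < m` forces j < m, so finitely many comparisons suffice.
  HasPeriod? : ∀ i m p → Dec (HasPeriod i m p)
  HasPeriod? i m p = 1 ≤? p ×-dec p ≤? m ×-dec map′
    (λ per j lt → per (≤-<-trans (m≤m+n j p) lt) lt) (λ per {j} _ → per j)
    (allUpTo? (λ j → (j + p <? m) →-dec (𝐧 (i + j) ≟ 𝐧 (i + j + p))) m)

  -- `N k` is only known to be some period of the factor; replacing it by the smallest one does not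
  -- decrease the exponent.
  IsPer-exists : ∀ {i m} p → HasPeriod i m p → ∃[ q ] (q ≤ p × IsPer i m q)
  IsPer-exists {i} {m} = <-rec _ step
    where
    step : ∀ p → (∀ {p′} → p′ < p → HasPeriod i m p′ → ∃[ q ] (q ≤ p′ × IsPer i m q)) →
           HasPeriod i m p → ∃[ q ] (q ≤ p × IsPer i m q)
    step p rec per with anyUpTo? (HasPeriod? i m) p
    ... | yes (p′ , p′<p , per′) = let q , q≤p′ , isPer = rec p′<p per′ in q , ≤-trans q≤p′ (<⇒≤ p′<p) , isPer
    ... | no none = p , ≤-refl , per , λ q q<p per′ → none (q , q<p , per′)

module Estimates where

  open import Data.Nat as ℕ using (ℕ; zero; suc)
  import Data.Nat.Properties as ℕ
  open import Data.Integer as ℤ using (+_; +[1+_]; -[1+_])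
  import Data.Integer.Properties as ℤ
  open import Data.Product using (_,_; ∃-syntax)
  open import Data.Sum using (inj₁; inj₂)
  open import Data.Rational as ℚ using (ℚ; 0ℚ; 1ℚ; mkℚ; _/_; _+_; _*_; _-_; -_; _≤_; _<_; _≮_; nonNegative; positive)
  open import Data.Rational.Properties as ℚ using (module ≤-Reasoning)
  open import Data.Rational.Solver using (module +-*-Solver)
  open import Data.Rational.Unnormalised as ℚᵘ using (mkℚᵘ; *≡*; *≤*)
  import Data.Rational.Unnormalised.Properties as ℚᵘ
  open import Relation.Binary.PropositionalEquality using (_≡_; refl; sym; trans; cong; cong₂; subst; subst₂; module ≡-Reasoning)
  open import Relation.Nullary using (contradiction)
  open import Relation.Nullary.Decidable using (toWitness)
  open Words using (N; N-pos; S)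

  -- Natural numbers as rationals

  ι : ℕ → ℚ
  ι n = + n / 1

  ι-+ : ∀ m n → ι (m ℕ.+ n) ≡ ι m + ι n
  ι-+ m n = ℚ.toℚᵘ-injective (begin
    ℚ.toℚᵘ (ι (m ℕ.+ n))                       ≈⟨ ℚ.toℚᵘ-fromℚᵘ (mkℚᵘ (+ (m ℕ.+ n)) 0) ⟩
    mkℚᵘ (+ (m ℕ.+ n)) 0                       ≈⟨ *≡* (cong (ℤ._* + 1) (sym (cong₂ ℤ._+_ (ℤ.*-identityʳ (+ m)) (ℤ.*-identityʳ (+ n))))) ⟩
    mkℚᵘ (+ m) 0 ℚᵘ.+ mkℚᵘ (+ n) 0             ≈⟨ ℚᵘ.+-cong (ℚ.toℚᵘ-fromℚᵘ (mkℚᵘ (+ m) 0)) (ℚ.toℚᵘ-fromℚᵘ (mkℚᵘ (+ n) 0)) ⟨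
    ℚ.toℚᵘ (ι m) ℚᵘ.+ ℚ.toℚᵘ (ι n)             ≈⟨ ℚ.toℚᵘ-homo-+ (ι m) (ι n) ⟨
    ℚ.toℚᵘ (ι m + ι n)                         ∎)
    where open ℚᵘ.≃-Reasoning

  ι-mono-≤ : ∀ {m n} → m ℕ.≤ n → ι m ≤ ι n
  ι-mono-≤ {m} {n} m≤n = ℚ.toℚᵘ-cancel-≤ (begin
    ℚ.toℚᵘ (ι m) ≃⟨ ℚ.toℚᵘ-fromℚᵘ (mkℚᵘ (+ m) 0) ⟩
    mkℚᵘ (+ m) 0 ≤⟨ *≤* (ℤ.*-monoʳ-≤-nonNeg (+ 1) (ℤ.+≤+ m≤n)) ⟩
    mkℚᵘ (+ n) 0 ≃⟨ ℚ.toℚᵘ-fromℚᵘ (mkℚᵘ (+ n) 0) ⟨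
    ℚ.toℚᵘ (ι n) ∎)
    where open ℚᵘ.≤-Reasoning

  ratio-* : ∀ m q → ratio m (suc q) * ι (suc q) ≡ ι m
  ratio-* m q = ℚ.toℚᵘ-injective (begin
    ℚ.toℚᵘ (ratio m (suc q) * ι (suc q))                ≈⟨ ℚ.toℚᵘ-homo-* (ratio m (suc q)) (ι (suc q)) ⟩
    ℚ.toℚᵘ (ratio m (suc q)) ℚᵘ.* ℚ.toℚᵘ (ι (suc q))    ≈⟨ ℚᵘ.*-cong (ℚ.toℚᵘ-fromℚᵘ (mkℚᵘ (+ m) q)) (ℚ.toℚᵘ-fromℚᵘ (mkℚᵘ (+ suc q) 0)) ⟩
    mkℚᵘ (+ m) q ℚᵘ.* mkℚᵘ (+ suc q) 0                  ≈⟨ *≡* (trans (ℤ.*-identityʳ (+ m ℤ.* + suc q)) (cong (λ x → + m ℤ.* (+ suc x)) (sym (ℕ.*-identityʳ q)))) ⟩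
    mkℚᵘ (+ m) 0                                        ≈⟨ ℚ.toℚᵘ-fromℚᵘ (mkℚᵘ (+ m) 0) ⟨
    ℚ.toℚᵘ (ι m)                                        ∎)
    where open ℚᵘ.≃-Reasoning

  0≤-+ : ∀ {p q} → 0ℚ ≤ p → 0ℚ ≤ q → 0ℚ ≤ p + q
  0≤-+ = ℚ.+-mono-≤

  0≤-* : ∀ {p q} → 0ℚ ≤ p → 0ℚ ≤ q → 0ℚ ≤ p * q
  0≤-* {p} {q} 0≤p 0≤q = ℚ.nonNegative⁻¹ (p * q)
    {{ℚ.nonNeg*nonNeg⇒nonNeg p {{nonNegative 0≤p}} q {{nonNegative 0≤q}}}}

  ≤⇒0≤ : ∀ {p q} → p ≤ q → 0ℚ ≤ q - p
  ≤⇒0≤ {p} {q} p≤q = subst (_≤ q - p) (ℚ.+-inverseʳ p) (ℚ.+-monoˡ-≤ (- p) p≤q)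

  difference : ∀ {p q d} → q - p ≡ d → 0ℚ ≤ d → p ≤ q
  difference {p} {q} {d} eq 0≤d = subst₂ _≤_ (ℚ.+-identityˡ p)
    (trans (cong (_+ p) (sym eq)) (solve 2 (λ p q → q :- p :+ p := q) refl p q)) (ℚ.+-monoˡ-≤ p 0≤d)
    where open +-*-Solver

  0≤ι : ∀ n → 0ℚ ≤ ι n
  0≤ι n = ι-mono-≤ (ℕ.z≤n {n})

  archimedean : ∀ {e} → 0ℚ < e → ∃[ n ] 1ℚ ≤ e * ι n
  archimedean {mkℚ (+ zero) d c} 0<e = contradiction (positive 0<e) λ ()
  -- The denominator is a witness: its product with e is the numerator.
  archimedean {e@(mkℚ +[1+ a ] d c)} 0<e = suc d , (begin
    1ℚ                            ≤⟨ ι-mono-≤ (ℕ.s≤s (ℕ.z≤n {a})) ⟩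
    ι (suc a)                     ≡⟨ ratio-* (suc a) d ⟨
    ratio (suc a) (suc d) * ι (suc d) ≡⟨ cong (_* ι (suc d)) (ℚ.↥p/↧p≡p e) ⟩
    e * ι (suc d)                 ∎)
    where open ≤-Reasoning
  archimedean {mkℚ -[1+ a ] d c} 0<e = contradiction (positive 0<e) λ ()

  -- The form F and its recurrence

  Nℚ : ℕ → ℚ
  Nℚ k = ι (N k)

  δ : ℚ → ℚ
  δ r = r * r * r - (r * r + 1ℚ)

  G : ℚ → ℚ → ℚ → ℚ → ℚ
  G r a b c = c + b - (r * r + r) * a

  -- The cofactor of -δ(r) in `G-recurrence`, arranged in terms of a, c - b and b - a, which are
  -- nonnegative for successive values of N.
  W : ℚ → ℚ → ℚ → ℚ → ℚ
  W r a b c = a + (1ℚ + 1ℚ + 1ℚ) * (c - b) + (1ℚ + 1ℚ - r) * (r + 1ℚ) * (b - a)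

  -- The factor X² + (r − 1)X + r(r − 1) of X³ − X² − 1 − δ(r) times (X − 1)(X + 2 − r) gives a
  -- recurrence with nonnegative coefficients of sum 1 for 1 ≤ r ≤ 3/2.
  G-recurrence : ∀ r a b c B →
    let c₃ = c + a ; c₄ = c₃ + b ; c₅ = c₄ + c ; c₆ = c₅ + c₃ in
    G r c₄ c₅ c₆ - B ≡
      (1ℚ + 1ℚ + 1ℚ - (r + r)) * (G r c c₃ c₄ - B)
      + (r - 1ℚ) * ((r - 1ℚ) * (r - 1ℚ) + 1ℚ) * (G r b c c₃ - B)
      + (1ℚ + 1ℚ - r) * (r * (r - 1ℚ)) * (G r a b c - B)
      + (- δ r) * W r a b c
  G-recurrence = solve 5 (λ r a b c B →
    let :G = λ a b c → c :+ b :- (r :* r :+ r) :* a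
        𝟙 = con 1ℚ
        c₃ = c :+ a ; c₄ = c₃ :+ b ; c₅ = c₄ :+ c ; c₆ = c₅ :+ c₃ in
    :G c₄ c₅ c₆ :- B :=
      (𝟙 :+ 𝟙 :+ 𝟙 :- (r :+ r)) :* (:G c c₃ c₄ :- B)
      :+ (r :- 𝟙) :* ((r :- 𝟙) :* (r :- 𝟙) :+ 𝟙) :* (:G b c c₃ :- B)
      :+ (𝟙 :+ 𝟙 :- r) :* (r :* (r :- 𝟙)) :* (:G a b c :- B)
      :+ (:- (r :* r :* r :- (r :* r :+ 𝟙))) :* (a :+ (𝟙 :+ 𝟙 :+ 𝟙) :* (c :- b) :+ (𝟙 :+ 𝟙 :- r) :* (r :+ 𝟙) :* (b :- a)))
    refl
    where open +-*-Solver

  ι-* : ∀ m k → ι (m ℕ.* k) ≡ ι m * ι k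
  ι-* zero    k = sym (ℚ.*-zeroˡ (ι k))
  ι-* (suc m) k = begin
    ι (k ℕ.+ m ℕ.* k)       ≡⟨ ι-+ k (m ℕ.* k) ⟩
    ι k + ι (m ℕ.* k)       ≡⟨ cong (λ x → ι k + x) (ι-* m k) ⟩
    ι k + ι m * ι k         ≡⟨ solve 2 (λ x y → x :+ y :* x := (con 1ℚ :+ y) :* x) refl (ι k) (ι m) ⟩
    (1ℚ + ι m) * ι k        ≡⟨ cong (_* ι k) (ι-+ 1 m) ⟨
    ι (suc m) * ι k         ∎
    where
    open ≡-Reasoning
    open +-*-Solver

  F : ℚ → ℕ → ℚ
  F r k = G r (Nℚ k) (Nℚ (1 ℕ.+ k)) (Nℚ (2 ℕ.+ k))

  -- Any constant B may be subtracted throughout because the coefficients sum to 1; a bound B on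
  -- three values thereby passes to the next one.
  F-recurrence : ∀ r k B →
    F r (4 ℕ.+ k) - B ≡
      (1ℚ + 1ℚ + 1ℚ - (r + r)) * (F r (2 ℕ.+ k) - B)
      + (r - 1ℚ) * ((r - 1ℚ) * (r - 1ℚ) + 1ℚ) * (F r (1 ℕ.+ k) - B)
      + (1ℚ + 1ℚ - r) * (r * (r - 1ℚ)) * (F r k - B)
      + (- δ r) * W r (Nℚ k) (Nℚ (1 ℕ.+ k)) (Nℚ (2 ℕ.+ k))
  F-recurrence r k B = go (Nℚ-rec k) (Nℚ-rec (1 ℕ.+ k)) (Nℚ-rec (2 ℕ.+ k)) (Nℚ-rec (3 ℕ.+ k))
    where
    Nℚ-rec : ∀ k → Nℚ (3 ℕ.+ k) ≡ Nℚ (2 ℕ.+ k) + Nℚ k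
    Nℚ-rec k = ι-+ (N (2 ℕ.+ k)) (N k)
    go : ∀ {a b c c₃ c₄ c₅ c₆} → c₃ ≡ c + a → c₄ ≡ c₃ + b → c₅ ≡ c₄ + c → c₆ ≡ c₅ + c₃ →
      G r c₄ c₅ c₆ - B ≡
        (1ℚ + 1ℚ + 1ℚ - (r + r)) * (G r c c₃ c₄ - B)
        + (r - 1ℚ) * ((r - 1ℚ) * (r - 1ℚ) + 1ℚ) * (G r b c c₃ - B)
        + (1ℚ + 1ℚ - r) * (r * (r - 1ℚ)) * (G r a b c - B)
        + (- δ r) * W r a b c
    go {a} {b} {c} refl refl refl refl = G-recurrence r a b c B

  N-mono-suc : ∀ k → N k ℕ.≤ N (1 ℕ.+ k)
  N-mono-suc 0 = ℕ.≤-refl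
  N-mono-suc 1 = ℕ.≤-refl
  N-mono-suc (suc (suc k)) = ℕ.m≤m+n (N (2 ℕ.+ k)) (N k)

  -- Slightly above α ≈ 1.4656, and the largest r for which the coefficient 3 - 2r is nonnegative.
  3/2 : ℚ
  3/2 = + 3 / 2

  -- Bounds on F for 1 ≤ r ≤ 3/2

  module _ {r : ℚ} (1≤r : 1ℚ ≤ r) (r≤3/2 : r ≤ 3/2) where

    open +-*-Solver

    0≤r-1 : 0ℚ ≤ r - 1ℚ
    0≤r-1 = ≤⇒0≤ 1≤r

    0≤3/2-r : 0ℚ ≤ 3/2 - r
    0≤3/2-r = ≤⇒0≤ r≤3/2

    0≤r : 0ℚ ≤ r
    0≤r = ℚ.≤-trans (ℚ.nonNegative⁻¹ 1ℚ) 1≤r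

    0≤2-r : 0ℚ ≤ 1ℚ + 1ℚ - r
    0≤2-r = ≤⇒0≤ (ℚ.≤-trans r≤3/2 (toWitness {a? = 3/2 ℚ.≤? (1ℚ + 1ℚ)} _))

    0≤3-2r : 0ℚ ≤ 1ℚ + 1ℚ + 1ℚ - (r + r)
    0≤3-2r = subst (0ℚ ≤_) (solve 1 (λ r → con 3/2 :- r :+ (con 3/2 :- r) := con 1ℚ :+ con 1ℚ :+ con 1ℚ :- (r :+ r)) refl r)
      (0≤-+ 0≤3/2-r 0≤3/2-r)

    W≥1 : ∀ k → 1ℚ ≤ W r (Nℚ k) (Nℚ (1 ℕ.+ k)) (Nℚ (2 ℕ.+ k))
    W≥1 k = difference
      (solve 4 (λ r a b c → let 𝟙 = con 1ℚ in
          a :+ (𝟙 :+ 𝟙 :+ 𝟙) :* (c :- b) :+ (𝟙 :+ 𝟙 :- r) :* (r :+ 𝟙) :* (b :- a) :- 𝟙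
          := (a :- 𝟙) :+ (𝟙 :+ 𝟙 :+ 𝟙) :* (c :- b) :+ (𝟙 :+ 𝟙 :- r) :* (r :+ 𝟙) :* (b :- a))
        refl r (Nℚ k) (Nℚ (1 ℕ.+ k)) (Nℚ (2 ℕ.+ k)))
      (0≤-+ (0≤-+ (≤⇒0≤ (ι-mono-≤ (N-pos k)))
                  (0≤-* (0≤ι 3) (≤⇒0≤ (ι-mono-≤ (N-mono-suc (1 ℕ.+ k))))))
            (0≤-* (0≤-* 0≤2-r (0≤-+ 0≤r (0≤ι 1))) (≤⇒0≤ (ι-mono-≤ (N-mono-suc k)))))

    convex : ∀ {x y z} → 0ℚ ≤ x → 0ℚ ≤ y → 0ℚ ≤ z →
      0ℚ ≤ (1ℚ + 1ℚ + 1ℚ - (r + r)) * z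
         + (r - 1ℚ) * ((r - 1ℚ) * (r - 1ℚ) + 1ℚ) * y
         + (1ℚ + 1ℚ - r) * (r * (r - 1ℚ)) * x
    convex 0≤x 0≤y 0≤z = 0≤-+ (0≤-+ (0≤-* 0≤3-2r 0≤z)
      (0≤-* (0≤-* 0≤r-1 (0≤-+ (0≤-* 0≤r-1 0≤r-1) (0≤ι 1))) 0≤y))
      (0≤-* (0≤-* 0≤2-r (0≤-* 0≤r 0≤r-1)) 0≤x)

    -- As the recurrence reaches back four places, there are four initial values; for r ≥ 1 they are
    -- at most 3, with equality at r = 1 for k = 2 and k = 3.
    F-upper : 0ℚ ≤ δ r → ∀ k → F r k ≤ ι 3
    F-upper 0≤δ 0 = difference
      (solve 1 (λ r → con (ι 3) :- (con 1ℚ :+ con 1ℚ :- (r :* r :+ r) :* con 1ℚ) := r :* r :+ r :+ con 1ℚ) refl r)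
      (0≤-+ (0≤-+ (0≤-* 0≤r 0≤r) 0≤r) (0≤ι 1))
    F-upper 0≤δ 1 = difference
      (solve 1 (λ r → con (ι 3) :- (con (ι 2) :+ con 1ℚ :- (r :* r :+ r) :* con 1ℚ) := r :* r :+ r) refl r)
      (0≤-+ (0≤-* 0≤r 0≤r) 0≤r)
    F-upper 0≤δ 2 = difference
      (solve 1 (λ r → con (ι 3) :- (con (ι 3) :+ con (ι 2) :- (r :* r :+ r) :* con 1ℚ)
                   := (r :- con 1ℚ) :* (r :+ con (ι 2))) refl r)
      (0≤-* 0≤r-1 (0≤-+ 0≤r (0≤ι 2)))
    F-upper 0≤δ 3 = difference
      (solve 1 (λ r → con (ι 3) :- (con (ι 4) :+ con (ι 3) :- (r :* r :+ r) :* con (ι 2))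
                   := con (ι 2) :* ((r :- con 1ℚ) :* (r :+ con (ι 2)))) refl r)
      (0≤-* (0≤ι 2) (0≤-* 0≤r-1 (0≤-+ 0≤r (0≤ι 2))))
    F-upper 0≤δ (suc (suc (suc (suc k)))) = difference
      (begin
        B - F r (4 ℕ.+ k)                    ≡⟨ solve 2 (λ x y → x :- y := :- (y :- x)) refl B (F r (4 ℕ.+ k)) ⟩
        - (F r (4 ℕ.+ k) - B)                ≡⟨ cong -_ (F-recurrence r k B) ⟩
        - (p₂ * (F₂ - B) + p₁ * (F₁ - B) + p₀ * (F₀ - B) + (- δ r) * w)
          ≡⟨ solve 9 (λ p₀ p₁ p₂ f₀ f₁ f₂ b d w →
               :- (p₂ :* (f₂ :- b) :+ p₁ :* (f₁ :- b) :+ p₀ :* (f₀ :- b) :+ (:- d) :* w)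
               := p₂ :* (b :- f₂) :+ p₁ :* (b :- f₁) :+ p₀ :* (b :- f₀) :+ d :* w)
               refl p₀ p₁ p₂ F₀ F₁ F₂ B (δ r) w ⟩
        p₂ * (B - F₂) + p₁ * (B - F₁) + p₀ * (B - F₀) + δ r * w ∎)
      (0≤-+ (convex (≤⇒0≤ (F-upper 0≤δ k)) (≤⇒0≤ (F-upper 0≤δ (suc k))) (≤⇒0≤ (F-upper 0≤δ (suc (suc k)))))
            (0≤-* 0≤δ (ℚ.≤-trans (0≤ι 1) (W≥1 k))))
      where
      open ≡-Reasoning
      B = ι 3
      F₀ = F r k
      F₁ = F r (1 ℕ.+ k)
      F₂ = F r (2 ℕ.+ k)
      p₀ = (1ℚ + 1ℚ - r) * (r * (r - 1ℚ))
      p₁ = (r - 1ℚ) * ((r - 1ℚ) * (r - 1ℚ) + 1ℚ)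
      p₂ = 1ℚ + 1ℚ + 1ℚ - (r + r)
      w = W r (Nℚ k) (Nℚ (1 ℕ.+ k)) (Nℚ (2 ℕ.+ k))

    -- The convex combination preserves the bound B, and the perturbation adds at least -δ(r)
    -- because W ≥ 1.
    F-increase : 0ℚ ≤ - δ r → ∀ B k → B ≤ F r k → B ≤ F r (1 ℕ.+ k) → B ≤ F r (2 ℕ.+ k) →
                 B + - δ r ≤ F r (4 ℕ.+ k)
    F-increase 0≤e B k h₀ h₁ h₂ = difference
      (begin
        F r (4 ℕ.+ k) - (B + - δ r)   ≡⟨ solve 3 (λ x b e → x :- (b :+ e) := x :- b :- e) refl (F r (4 ℕ.+ k)) B (- δ r) ⟩
        F r (4 ℕ.+ k) - B - - δ r     ≡⟨ cong (_- - δ r) (F-recurrence r k B) ⟩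
        c + (- δ r) * w - - δ r       ≡⟨ solve 3 (λ c e w → c :+ e :* w :- e := c :+ e :* (w :- con 1ℚ)) refl c (- δ r) w ⟩
        c + (- δ r) * (w - 1ℚ)        ∎)
      (0≤-+ (convex (≤⇒0≤ h₀) (≤⇒0≤ h₁) (≤⇒0≤ h₂)) (0≤-* 0≤e (≤⇒0≤ (W≥1 k))))
      where
      open ≡-Reasoning
      c = (1ℚ + 1ℚ + 1ℚ - (r + r)) * (F r (2 ℕ.+ k) - B)
        + (r - 1ℚ) * ((r - 1ℚ) * (r - 1ℚ) + 1ℚ) * (F r (1 ℕ.+ k) - B)
        + (1ℚ + 1ℚ - r) * (r * (r - 1ℚ)) * (F r k - B)
      w = W r (Nℚ k) (Nℚ (1 ℕ.+ k)) (Nℚ (2 ℕ.+ k))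

    r²+r≤15/4 : 0ℚ ≤ + 15 / 4 - (r * r + r)
    r²+r≤15/4 = subst (0ℚ ≤_)
      (solve 1 (λ r → (con 3/2 :- r) :* (r :+ con (+ 5 / 2)) := con (+ 15 / 4) :- (r :* r :+ r)) refl r)
      (0≤-* 0≤3/2-r (0≤-+ 0≤r (toWitness {a? = 0ℚ ℚ.≤? (+ 5 / 2)} _)))

    -- The initial values decrease in r and are -7/4, -3/4, 5/4, -1/2 at r = 3/2, where r² + r =
    -- 15/4; hence the bound -2.
    F-lower₀ : 0ℚ ≤ - δ r → ∀ k → - ι 2 ≤ F r k
    F-lower₀ 0≤e 0 = difference
      (solve 1 (λ r → con 1ℚ :+ con 1ℚ :- (r :* r :+ r) :* con 1ℚ :- con (- ι 2)
                   := con (+ 1 / 4) :+ (con (+ 15 / 4) :- (r :* r :+ r))) refl r)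
      (0≤-+ (toWitness {a? = 0ℚ ℚ.≤? (+ 1 / 4)} _) r²+r≤15/4)
    F-lower₀ 0≤e 1 = difference
      (solve 1 (λ r → con (ι 2) :+ con 1ℚ :- (r :* r :+ r) :* con 1ℚ :- con (- ι 2)
                   := con (+ 5 / 4) :+ (con (+ 15 / 4) :- (r :* r :+ r))) refl r)
      (0≤-+ (toWitness {a? = 0ℚ ℚ.≤? (+ 5 / 4)} _) r²+r≤15/4)
    F-lower₀ 0≤e 2 = difference
      (solve 1 (λ r → con (ι 3) :+ con (ι 2) :- (r :* r :+ r) :* con 1ℚ :- con (- ι 2)
                   := con (+ 13 / 4) :+ (con (+ 15 / 4) :- (r :* r :+ r))) refl r)
      (0≤-+ (toWitness {a? = 0ℚ ℚ.≤? (+ 13 / 4)} _) r²+r≤15/4)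
    F-lower₀ 0≤e 3 = difference
      (solve 1 (λ r → con (ι 4) :+ con (ι 3) :- (r :* r :+ r) :* con (ι 2) :- con (- ι 2)
                   := con 3/2 :+ con (ι 2) :* (con (+ 15 / 4) :- (r :* r :+ r))) refl r)
      (0≤-+ (toWitness {a? = 0ℚ ℚ.≤? 3/2} _) (0≤-* (0≤ι 2) r²+r≤15/4))
    F-lower₀ 0≤e (suc (suc (suc (suc k)))) = ℚ.≤-trans
      (ℚ.≤-trans (ℚ.≤-reflexive (sym (ℚ.+-identityʳ (- ι 2)))) (ℚ.+-monoʳ-≤ (- ι 2) 0≤e))
      (F-increase 0≤e (- ι 2) k (F-lower₀ 0≤e k) (F-lower₀ 0≤e (suc k)) (F-lower₀ 0≤e (suc (suc k))))

    -- Every four places gain -δ(r). The claim is made for all `k` because `F-increase` needs it at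
    -- three consecutive places.
    F-lower : 0ℚ ≤ - δ r → ∀ t k → (- δ r) * ι t - ι 2 ≤ F r (t ℕ.* 4 ℕ.+ k)
    F-lower 0≤e zero k = subst (_≤ F r k)
      (solve 1 (λ e → con (- ι 2) := e :* con 0ℚ :- con (ι 2)) refl (- δ r)) (F-lower₀ 0≤e k)
    F-lower 0≤e (suc t) k = subst (_≤ F r (4 ℕ.+ (t ℕ.* 4 ℕ.+ k)))
      (begin
        (- δ r) * ι t - ι 2 + - δ r     ≡⟨ solve 2 (λ e t → e :* t :- con (ι 2) :+ e := e :* (con 1ℚ :+ t) :- con (ι 2)) refl (- δ r) (ι t) ⟩
        (- δ r) * (1ℚ + ι t) - ι 2      ≡⟨ cong (λ x → (- δ r) * x - ι 2) (sym (ι-+ 1 t)) ⟩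
        (- δ r) * ι (suc t) - ι 2       ∎)
      (F-increase 0≤e ((- δ r) * ι t - ι 2) (t ℕ.* 4 ℕ.+ k) (F-lower 0≤e t k) (later 1) (later 2))
      where
      open ≡-Reasoning
      later : ∀ j → (- δ r) * ι t - ι 2 ≤ F r (j ℕ.+ (t ℕ.* 4 ℕ.+ k))
      later j = subst (λ x → (- δ r) * ι t - ι 2 ≤ F r x)
        (trans (sym (ℕ.+-assoc (t ℕ.* 4) j k)) (trans (cong (ℕ._+ k) (ℕ.+-comm (t ℕ.* 4) j)) (ℕ.+-assoc j (t ℕ.* 4) k)))
        (F-lower 0≤e t (j ℕ.+ k))

    F-unbounded : 0ℚ < - δ r → ∃[ k ] ι 6 ≤ F r k
    F-unbounded 0<e with archimedean 0<e
    -- Of the 8 units gained, 2 make up for the initial bound -2 and 6 remain.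
    ... | t , 1≤et = 8 ℕ.* t ℕ.* 4 ℕ.+ 0 , ℚ.≤-trans
      (difference
        (begin
          (- δ r) * ι (8 ℕ.* t) - ι 2 - ι 6     ≡⟨ cong (λ x → (- δ r) * x - ι 2 - ι 6) (ι-* 8 t) ⟩
          (- δ r) * (ι 8 * ι t) - ι 2 - ι 6     ≡⟨ solve 2 (λ e t → e :* (con (ι 8) :* t) :- con (ι 2) :- con (ι 6)
                                                      := con (ι 8) :* (e :* t :- con 1ℚ)) refl (- δ r) (ι t) ⟩
          ι 8 * ((- δ r) * ι t - 1ℚ)            ∎)
        (0≤-* (0≤ι 8) (≤⇒0≤ 1≤et)))
      (F-lower (ℚ.<⇒≤ 0<e) (8 ℕ.* t) 0)
      where open ≡-Reasoning

  -- Extension to all r on either side of α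

  0≤square : ∀ r → 0ℚ ≤ r * r
  0≤square r with ℚ.≤-total 0ℚ r
  ... | inj₁ 0≤r = 0≤-* 0≤r 0≤r
  ... | inj₂ r≤0 = subst (0ℚ ≤_) (solve 1 (λ r → (con 0ℚ :- r) :* (con 0ℚ :- r) := r :* r) refl r)
                     (0≤-* (≤⇒0≤ r≤0) (≤⇒0≤ r≤0))
    where open +-*-Solver

  <⇒0< : ∀ {p q} → p < q → 0ℚ < q - p
  <⇒0< {p} {q} p<q = subst (_< q - p) (ℚ.+-inverseʳ p) (ℚ.+-monoˡ-< (- p) p<q)

  ≤⇒≯ : ∀ {p q} → p ≤ q → q ≮ p
  ≤⇒≯ p≤q q<p = ℚ.<-irrefl refl (ℚ.≤-<-trans p≤q q<p)

  AboveAlpha⇒1≤ : ∀ {r} → AboveAlpha r → 1ℚ ≤ r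
  AboveAlpha⇒1≤ {r} above with ℚ.≤-total 1ℚ r
  ... | inj₁ 1≤r = 1≤r
  ... | inj₂ r≤1 = contradiction above (≤⇒≯ (difference
    (solve 1 (λ r → r :* r :+ con 1ℚ :- r :* r :* r := r :* r :* (con 1ℚ :- r) :+ con 1ℚ) refl r)
    (0≤-+ (0≤-* (0≤square r) (≤⇒0≤ r≤1)) (0≤ι 1))))
    where open +-*-Solver

  BelowAlpha⇒≤3/2 : ∀ {r} → BelowAlpha r → r ≤ 3/2
  BelowAlpha⇒≤3/2 {r} below with ℚ.≤-total r 3/2
  ... | inj₁ r≤3/2 = r≤3/2
  ... | inj₂ 3/2≤r = contradiction below (≤⇒≯ (difference
    -- Taylor expansion of r³ - r² - 1 at 3/2; all its coefficients are positive.
    (solve 1 (λ r → let s = r :- con 3/2 in r :* r :* r :- (r :* r :+ con 1ℚ)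
       := s :* (s :* s :+ con (+ 7 / 2) :* s :+ con (+ 15 / 4)) :+ con (+ 1 / 8)) refl r)
    (0≤-+ (0≤-* 0≤s (0≤-+ (0≤-+ (0≤-* 0≤s 0≤s) (0≤-* (toWitness {a? = 0ℚ ℚ.≤? (+ 7 / 2)} _) 0≤s))
       (toWitness {a? = 0ℚ ℚ.≤? (+ 15 / 4)} _))) (toWitness {a? = 0ℚ ℚ.≤? (+ 1 / 8)} _))))
    where
    open +-*-Solver
    0≤s : 0ℚ ≤ r - 3/2
    0≤s = ≤⇒0≤ 3/2≤r

  -- Reduces r ≥ 3/2 to 3/2 in `F-bounded`, and r ≤ 1 to 1 in `F-large`.
  F-antitone : ∀ {r s} → 0ℚ ≤ r → r ≤ s → ∀ k → F s k ≤ F r k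
  F-antitone {r} {s} 0≤r r≤s k = difference
    (solve 5 (λ r s a b c → c :+ b :- (r :* r :+ r) :* a :- (c :+ b :- (s :* s :+ s) :* a)
       := (s :- r) :* (r :+ s :+ con 1ℚ) :* a) refl r s (Nℚ k) (Nℚ (1 ℕ.+ k)) (Nℚ (2 ℕ.+ k)))
    (0≤-* (0≤-* (≤⇒0≤ r≤s) (0≤-+ (0≤-+ 0≤r (ℚ.≤-trans 0≤r r≤s)) (0≤ι 1))) (0≤ι (N k)))
    where open +-*-Solver

  F-bounded : ∀ r → AboveAlpha r → ∀ k → F r k ≤ ι 3
  F-bounded r above k with ℚ.≤-total r 3/2
  ... | inj₁ r≤3/2 = F-upper (AboveAlpha⇒1≤ above) r≤3/2 (≤⇒0≤ (ℚ.<⇒≤ above)) k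
  ... | inj₂ 3/2≤r = ℚ.≤-trans (F-antitone {3/2} (toWitness {a? = 0ℚ ℚ.≤? 3/2} _) 3/2≤r k)
    (F-upper {3/2} (toWitness {a? = 1ℚ ℚ.≤? 3/2} _) ℚ.≤-refl (toWitness {a? = 0ℚ ℚ.≤? δ 3/2} _) k)

  F-large : ∀ r → 0ℚ ≤ r → BelowAlpha r → ∃[ k ] ι 6 ≤ F r k
  F-large r 0≤r below with ℚ.≤-total 1ℚ r
  ... | inj₁ 1≤r = F-unbounded 1≤r (BelowAlpha⇒≤3/2 below) (subst (0ℚ <_)
          (solve 1 (λ r → r :* r :+ con 1ℚ :- r :* r :* r := :- (r :* r :* r :- (r :* r :+ con 1ℚ))) refl r)
          (<⇒0< below))
    where open +-*-Solver
  ... | inj₂ r≤1 =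
    let k , large = F-unbounded {1ℚ} ℚ.≤-refl (toWitness {a? = 1ℚ ℚ.≤? 3/2} _) (toWitness {a? = 0ℚ ℚ.<? (- δ 1ℚ)} _)
    in k , ℚ.≤-trans large (F-antitone 0≤r r≤1 k)

  -- From F to exponents

  ι-S : ∀ k p → ι (S k ℕ.+ 3 ℕ.* p) ≡ Nℚ (2 ℕ.+ k) + Nℚ (1 ℕ.+ k) + ι 2 * Nℚ k + ι 3 * ι p
  ι-S k p = begin
    ι (S k ℕ.+ 3 ℕ.* p)                                              ≡⟨ ι-+ (S k) (3 ℕ.* p) ⟩
    ι (S k) + ι (3 ℕ.* p)                                            ≡⟨ cong₂ _+_ (ι-+ (N (2 ℕ.+ k) ℕ.+ N (1 ℕ.+ k)) (2 ℕ.* N k)) (ι-* 3 p) ⟩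
    ι (N (2 ℕ.+ k) ℕ.+ N (1 ℕ.+ k)) + ι (2 ℕ.* N k) + ι 3 * ι p       ≡⟨ cong₂ (λ x y → x + y + ι 3 * ι p) (ι-+ (N (2 ℕ.+ k)) (N (1 ℕ.+ k))) (ι-* 2 (N k)) ⟩
    Nℚ (2 ℕ.+ k) + Nℚ (1 ℕ.+ k) + ι 2 * Nℚ k + ι 3 * ι p                 ∎
    where open ≡-Reasoning

  ι-3m+ : ∀ m c → ι (3 ℕ.* m ℕ.+ c) ≡ ι 3 * ι m + ι c
  ι-3m+ m c = trans (ι-+ (3 ℕ.* m) c) (cong (_+ ι c) (ι-* 3 m))

  1/3 : ℚ
  1/3 = + 1 / 3

  0≤1/3 : 0ℚ ≤ 1/3
  0≤1/3 = toWitness {a? = 0ℚ ℚ.≤? 1/3} _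

  <-+1/3 : ∀ p → p < p + 1/3
  <-+1/3 p = subst (_< p + 1/3) (ℚ.+-identityʳ p) (ℚ.+-monoʳ-< p (toWitness {a? = 0ℚ ℚ.<? 1/3} _))

  -- S k is F r k + (r² + r + 2) N k. Since 4 exceeds the bound 3 on F by one, 3m + 1 ≤ 3 f(r) p,
  -- and the margin 1/3 makes the inequality strict.
  ratio-upper : ∀ r m {p} k → 1 ℕ.≤ p → 3 ℕ.* m ℕ.+ 4 ℕ.≤ S k ℕ.+ 3 ℕ.* p → N k ℕ.≤ p →
                F r k ≤ ι 3 → ratio m p < f r
  ratio-upper r m {suc q} k _ length≤ N≤p F≤ = ℚ.*-cancelʳ-<-nonNeg (ι p) {{nonNegative (0≤ι p)}} (begin-strict
    ratio m p * ι p   ≡⟨ ratio-* m q ⟩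
    ι m               <⟨ <-+1/3 (ι m) ⟩
    ι m + 1/3         ≤⟨ difference
      (solve 6 (λ r a b c m p →
         (r :* r :+ r :+ con (ι 5)) :* con 1/3 :* p :- (m :+ con 1/3)
         := con 1/3 :* ((c :+ b :+ con (ι 2) :* a :+ con (ι 3) :* p :- (con (ι 3) :* m :+ con (ι 4)))
                         :+ (con (ι 3) :- (c :+ b :- (r :* r :+ r) :* a))
                         :+ (r :* r :+ r :+ con (ι 2)) :* (p :- a)))
         refl r (Nℚ k) (Nℚ (1 ℕ.+ k)) (Nℚ (2 ℕ.+ k)) (ι m) (ι p))
      (0≤-* 0≤1/3 (0≤-+ (0≤-+ (≤⇒0≤ length≤′) (≤⇒0≤ F≤)) (0≤-* 0≤r²+r+2 (≤⇒0≤ (ι-mono-≤ N≤p))))) ⟩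
    f r * ι p         ∎)
    where
    open ≤-Reasoning
    open +-*-Solver
    p = suc q
    length≤′ : ι 3 * ι m + ι 4 ≤ Nℚ (2 ℕ.+ k) + Nℚ (1 ℕ.+ k) + ι 2 * Nℚ k + ι 3 * ι p
    length≤′ = subst₂ _≤_ (ι-3m+ m 4) (ι-S k p) (ι-mono-≤ length≤)
    0≤r²+r+2 : 0ℚ ≤ r * r + r + ι 2
    0≤r²+r+2 = subst (0ℚ ≤_)
      (solve 1 (λ r → (r :+ con (+ 1 / 2)) :* (r :+ con (+ 1 / 2)) :+ con (+ 7 / 4) := r :* r :+ r :+ con (ι 2)) refl r)
      (0≤-+ (0≤square (r + + 1 / 2)) (toWitness {a? = 0ℚ ℚ.≤? (+ 7 / 4)} _))

  -- Here 6 exceeds the constant 5 of the length bound by one, with the same margin 1/3.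
  ratio-lower : ∀ r m {p} k → 0ℚ ≤ r → 1 ℕ.≤ p → S k ℕ.+ 3 ℕ.* N k ℕ.≤ 3 ℕ.* m ℕ.+ 5 → p ℕ.≤ N k →
                ι 6 ≤ F r k → f r < ratio m p
  ratio-lower r m {suc q} k 0≤r _ length≤ p≤N F≥ = ℚ.*-cancelʳ-<-nonNeg (ι p) {{nonNegative (0≤ι p)}} (begin-strict
    f r * ι p           <⟨ <-+1/3 (f r * ι p) ⟩
    f r * ι p + 1/3     ≤⟨ difference
      (solve 6 (λ r a b c m p →
         m :- ((r :* r :+ r :+ con (ι 5)) :* con 1/3 :* p :+ con 1/3)
         := con 1/3 :* ((con (ι 3) :* m :+ con (ι 5) :- (c :+ b :+ con (ι 2) :* a :+ con (ι 3) :* a))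
                         :+ (c :+ b :- (r :* r :+ r) :* a :- con (ι 6))
                         :+ (r :* r :+ r :+ con (ι 5)) :* (a :- p)))
         refl r (Nℚ k) (Nℚ (1 ℕ.+ k)) (Nℚ (2 ℕ.+ k)) (ι m) (ι p))
      (0≤-* 0≤1/3 (0≤-+ (0≤-+ (≤⇒0≤ length≤′) (≤⇒0≤ F≥))
         (0≤-* (0≤-+ (0≤-+ (0≤-* 0≤r 0≤r) 0≤r) (0≤ι 5)) (≤⇒0≤ (ι-mono-≤ p≤N))))) ⟩
    ι m                 ≡⟨ ratio-* m q ⟨
    ratio m p * ι p     ∎)
    where
    open ≤-Reasoning
    open +-*-Solver
    p = suc q
    length≤′ : Nℚ (2 ℕ.+ k) + Nℚ (1 ℕ.+ k) + ι 2 * Nℚ k + ι 3 * Nℚ k ≤ ι 3 * ι m + ι 5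
    length≤′ = subst₂ _≤_ (ι-S k (N k)) (ι-3m+ m 5) (ι-mono-≤ length≤)

-- Combination of the word lengths with the estimates

open import Data.Nat using (ℕ; _≤_)
open import Data.Rational using (ℚ; 0ℚ) renaming (_<_ to _<ℚ_; _≤_ to _≤ℚ_)
open import Data.Product using (_×_; ∃-syntax; _,_; proj₁)
open import Data.Nat.Properties using (≤-trans)
open Words using (HasPeriod-bound; HasPeriod-exists; IsPer-exists; N)
open Estimates using (F-bounded; F-large; ratio-upper; ratio-lower)

theorem11 : ((i m p : ℕ) → 1 ≤ m → IsPer i m p →
    (r : ℚ) → AboveAlpha r → ratio m p <ℚ f r)
    × ((r : ℚ) → 0ℚ ≤ℚ r → BelowAlpha r →
    ∃[ i ] ∃[ m ] ∃[ p ] (1 ≤ m × IsPer i m p × f r <ℚ ratio m p))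
theorem11 = upper , lower
  where
  upper : (i m p : ℕ) → 1 ≤ m → IsPer i m p → (r : ℚ) → AboveAlpha r → ratio m p <ℚ f r
  upper i m p _ (per , _) r above with HasPeriod-bound {i} {m} {p} per
  ... | k , length≤ , N≤p = ratio-upper r m k (proj₁ per) length≤ N≤p (F-bounded r above k)
  lower : (r : ℚ) → 0ℚ ≤ℚ r → BelowAlpha r →
          ∃[ i ] ∃[ m ] ∃[ p ] (1 ≤ m × IsPer i m p × f r <ℚ ratio m p)
  lower r 0≤r below with F-large r 0≤r below
  ... | k , large with HasPeriod-exists k
  ...   | i , m , per , length≤ with IsPer-exists {i} {m} (N k) per
  ...     | p , p≤N , isPer@((1≤p , p≤m , _) , _) =
    i , m , p , ≤-trans 1≤p p≤m , isPer , ratio-lower r m k 0≤r 1≤p length≤ p≤N large
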